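{- Consider the following random graph process: start with two vertices joined by an edge; at each time step choose an edge $\{u,w\}$ of the current graph uniformly at random, add a new vertex $v$, and add the edges $\{v,u\}$ and $\{v,w\}$. Then the local clustering coefficient of a vertex with degree $d$ is $2/d$ at any time of the generation process.
   Context: The local clustering coefficient of a vertex $i$ of degree $d_i$ is $\dfrac{2E_i}{d_i(d_i-1)}$, where $E_i$ is the number of edges among the neighbors of $i$. The process is the algorithm called SE-A with parameter $z=1$ (for which the sampling step amounts to a uniformly random edge selection) and with initial graph consisting of two connected vertices. -}

module Defs where

open import Data.Empty using (⊥)
open import Data.Fin.Base using (Fin; zero; suc; _<_)
open import Data.Fin.Properties using (_≟_; _<?_)
open import Data.Integer.Base using (+_)
open import Data.List.Base using (List; []; _∷_; map; concatMap; filter; length; allFin; cartesianProduct)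
open import Data.List.Membership.Propositional.Properties
  using (∈-filter⁺; ∈-cartesianProduct⁺; ∈-allFin; ∈-length)
open import Data.Nat.Base as ℕ using (ℕ; NonZero; NonTrivial; _∸_; s≤s; z≤n)
open import Data.Nat.Properties using (m*n≢0; m<n⇒0<n∸m)
open import Data.Product.Base using (Σ-syntax; _×_; _,_; proj₂)
open import Data.Rational.Base as ℚ using (ℚ; 1ℚ; _/_)
open import Data.Sum.Base using (_⊎_; inj₁)
open import Level using (Level; 0ℓ)
open import Relation.Binary.Core using (Rel)
open import Relation.Binary.Definitions using (Decidable; Symmetric)
open import Relation.Binary.PropositionalEquality.Core using (_≡_; refl; _≢_; ≢-sym)
open import Relation.Nullary.Decidable using (no; ¬?; _×-dec_; _⊎-dec_)
open import Relation.Nullary.Negation using (¬_)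

private
  variable
    a b : Level
    A : Set a
    B : Set b
    n : ℕ

record Graph (n : ℕ) : Set₁ where
  field
    Adj    : Rel (Fin n) 0ℓ
    adj?   : Decidable Adj
    sym    : Symmetric Adj
    irrefl : ∀ i → ¬ Adj i i

  -- Each undirected edge {j , k} is listed exactly once, as the pair with j < k.
  edges : List (Fin n × Fin n)
  edges = filter (λ (j , k) → (j <? k) ×-dec adj? j k)
                 (cartesianProduct (allFin n) (allFin n))

  neighbours : Fin n → List (Fin n)
  neighbours i = filter (adj? i) (allFin n)

  degree : Fin n → ℕ
  degree i = length (neighbours i)

  edgesAmongNeighbours : Fin n → ℕ
  edgesAmongNeighbours i =
    length (filter (λ (j , k) → adj? i j ×-dec adj? i k) edges)

open Graph

d[d-1]≢0 : ∀ d .{{_ : NonTrivial d}} → NonZero (d ℕ.* (d ∸ 1))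
d[d-1]≢0 d = m*n≢0 d (d ∸ 1) {{ℕ.nonTrivial⇒nonZero d}}
  {{ℕ.>-nonZero (m<n⇒0<n∸m (ℕ.nonTrivial⇒n>1 d))}}

-- The denominator vanishes for degrees 0 and 1, where the coefficient is undefined.
localClustering : (G : Graph n) (i : Fin n) .{{_ : NonTrivial (degree G i)}} → ℚ
localClustering G i =
  (+ (2 ℕ.* edgesAmongNeighbours G i) / (degree G i ℕ.* (degree G i ∸ 1)))
    {{d[d-1]≢0 (degree G i)}}

K₂ : Graph 2
K₂ = record
  { Adj    = _≢_
  ; adj?   = λ i j → ¬? (i ≟ j)
  ; sym    = ≢-sym
  ; irrefl = λ i i≢i → i≢i refl
  }

-- The new vertex is zero; an old vertex i is renamed suc i.
module _ (G : Graph n) (u w : Fin n) where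

  AttachAdj : Rel (Fin (ℕ.suc n)) 0ℓ
  AttachAdj zero    zero    = ⊥
  AttachAdj zero    (suc j) = j ≡ u ⊎ j ≡ w
  AttachAdj (suc i) zero    = i ≡ u ⊎ i ≡ w
  AttachAdj (suc i) (suc j) = Adj G i j

  attach : Graph (ℕ.suc n)
  attach = record
    { Adj    = AttachAdj
    ; adj?   = dec
    ; sym    = λ {i} {j} → symm i j
    ; irrefl = irr
    }
    where
    dec : Decidable AttachAdj
    dec zero    zero    = no λ ()
    dec zero    (suc j) = (j ≟ u) ⊎-dec (j ≟ w)
    dec (suc i) zero    = (i ≟ u) ⊎-dec (i ≟ w)
    dec (suc i) (suc j) = adj? G i j

    symm : ∀ i j → AttachAdj i j → AttachAdj j i
    symm zero    (suc j) p = p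
    symm (suc i) zero    p = p
    symm (suc i) (suc j) p = sym G p

    irr : ∀ i → ¬ AttachAdj i i
    irr (suc i) p = irrefl G i p

-- Finitely supported probability distributions, as lists of weighted outcomes.
Dist : Set a → Set a
Dist A = List (ℚ × A)

return : A → Dist A
return x = (1ℚ , x) ∷ []

bind : Dist A → (A → Dist B) → Dist B
bind μ f = concatMap (λ (p , x) → map (λ (q , y) → (p ℚ.* q , y)) (f x)) μ

uniform : (xs : List A) .{{_ : NonZero (length xs)}} → Dist A
uniform xs = map (λ x → (+ 1 / length xs , x)) xs

-- All weights occurring in the process below are positive.
support : Dist A → List A
support μ = map proj₂ μ

-- Non-emptiness of the edge set, without which there is no edge to sample.
HasEdge : Graph n → Set
HasEdge G = NonZero (length (edges G))

hasEdge : (G : Graph n) {j k : Fin n} → j < k → Adj G j k → HasEdge G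
hasEdge G {j} {k} j<k jk = ℕ.>-nonZero (∈-length
  (∈-filter⁺ (λ (j , k) → (j <? k) ×-dec adj? G j k)
    (∈-cartesianProduct⁺ (∈-allFin j) (∈-allFin k)) (j<k , jk)))

State : ℕ → Set₁
State n = Σ[ G ∈ Graph n ] HasEdge G

initial : State 2
initial = K₂ , hasEdge K₂ {zero} {suc zero} (s≤s z≤n) (λ ())

grow : Graph n → Fin n × Fin n → State (ℕ.suc n)
grow G (u , w) =
  attach G u w , hasEdge (attach G u w) {zero} {suc u} (s≤s z≤n) (inj₁ refl)

step : State n → Dist (State (ℕ.suc n))
step (G , ne) = bind (uniform (edges G) {{ne}}) (λ e → return (grow G e))

process : (t : ℕ) → Dist (State (2 ℕ.+ t))
process ℕ.zero    = return initial
process (ℕ.suc t) = bind (process t) step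

{-# OPTIONS --safe #-}
-- Every reachable graph satisfies d = E + 1 at each vertex, where d is the degree and E
-- the number of edges among the neighbours.  Attaching a new vertex to the edge {u , w}
-- gives it the neighbours u and w, which span one edge.  Each of u and w gains one
-- neighbour, whose only other edge leads to the other endpoint, so both of its counts
-- grow by one; all other vertices keep theirs.  Hence 2E / (d(d - 1)) = 2 / d.
module Submission where

open import Defs
open import Data.Fin.Base using (Fin; zero; suc; _<_)
open import Data.Fin.Properties using (_≟_; _<?_; suc-injective; <-asym; <-irrefl)
open import Data.Integer.Base as ℤ using (+_)
open import Data.Integer.Properties using (pos-*)
open import Data.List.Base using (List; []; _∷_; map; filter; length; allFin; cartesianProduct)
open import Data.List.Membership.Propositional using (_∈_; find)
open import Data.List.Membership.Propositional.Properties
  using (∈-filter⁺; ∈-filter⁻; ∈-cartesianProduct⁺; ∈-allFin; ∈-map⁺; ∈-map⁻; ∈-concatMap⁻)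
open import Data.List.Membership.Propositional.Properties.WithK using (unique∧set⇒bag)
open import Data.List.Properties using (length-map)
open import Data.List.Relation.Binary.BagAndSetEquality using (∼bag⇒↭)
open import Data.List.Relation.Binary.Permutation.Propositional.Properties using (↭-length)
open import Data.List.Relation.Binary.Subset.Propositional using (_⊆_)
open import Data.List.Relation.Unary.All.Properties using (¬Any⇒All¬)
open import Data.List.Relation.Unary.AllPairs using ([]; _∷_)
open import Data.List.Relation.Unary.Any using (here; there)
open import Data.List.Relation.Unary.Unique.Propositional using (Unique)
import Data.List.Relation.Unary.Unique.Propositional.Properties as Unique
open import Data.Nat.Base using (ℕ; zero; suc; NonZero; NonTrivial; nonTrivial⇒nonZero; _*_; _∸_; s≤s; z≤n; s<s) renaming (_+_ to _+ℕ_)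
open import Data.Nat.Properties using (*-assoc; *-comm)
open import Data.Product.Base using (∃-syntax; _×_; _,_; proj₁; proj₂)
open import Data.Rational.Base using (_/_)
open import Data.Rational.Properties using (fromℚᵘ-cong)
open import Data.Rational.Unnormalised.Base using (mkℚᵘ; *≡*)
open import Data.Sum.Base using (_⊎_; inj₁; inj₂)
open import Function.Bundles using (mk⇔)
open import Level using (Level)
open import Relation.Binary.PropositionalEquality.Core using (_≡_; refl; sym; trans; cong; subst)
open import Relation.Nullary.Decidable using (yes; no; _×-dec_; _⊎-dec_)
open import Relation.Nullary.Negation using (¬_; contradiction)
open Graph using (Adj; adj?; irrefl; edges; neighbours; degree; edgesAmongNeighbours) renaming (sym to Adj-sym)

private
  variable
    a b : Level
    A : Set a
    B : Set b
    n : ℕ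

-- Without repetitions, equality as sets already gives a permutation. Degrees and edge counts below
-- are all compared this way: exhibit the expected list and check both inclusions.
unique-length : {xs ys : List A} → Unique xs → Unique ys → xs ⊆ ys → ys ⊆ xs → length xs ≡ length ys
unique-length xs! ys! xs⊆ys ys⊆xs =
  ↭-length (∼bag⇒↭ (unique∧set⇒bag xs! ys! (mk⇔ xs⊆ys ys⊆xs)))

unique-∷ : {x : A} {xs : List A} → ¬ (x ∈ xs) → Unique xs → Unique (x ∷ xs)
unique-∷ x∉xs xs! = ¬Any⇒All¬ _ x∉xs ∷ xs!

-- Neighbours and opposite edges as duplicate-free lists

module _ (G : Graph n) where

  ∈-neighbours⁺ : ∀ {i j} → Adj G i j → j ∈ neighbours G i
  ∈-neighbours⁺ {i} = ∈-filter⁺ (adj? G i) (∈-allFin _)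

  ∈-neighbours⁻ : ∀ {i j} → j ∈ neighbours G i → Adj G i j
  ∈-neighbours⁻ {i} j∈ = proj₂ (∈-filter⁻ (adj? G i) {xs = allFin n} j∈)

  neighbours-! : ∀ i → Unique (neighbours G i)
  neighbours-! i = Unique.filter⁺ (adj? G i) (Unique.allFin⁺ n)

  ∈-edges⁻ : ∀ {j k} → (j , k) ∈ edges G → j < k × Adj G j k
  ∈-edges⁻ e∈ = proj₂ (∈-filter⁻ (λ (j , k) → (j <? k) ×-dec adj? G j k)
    {xs = cartesianProduct (allFin n) (allFin n)} e∈)

  -- The list whose length is, by definition, `edgesAmongNeighbours G i`; naming it allows reasoning
  -- about its members.
  oppositeEdges : Fin n → List (Fin n × Fin n)
  oppositeEdges i = filter (λ (j , k) → adj? G i j ×-dec adj? G i k) (edges G)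

  Opposite : Fin n → Fin n × Fin n → Set
  Opposite i (j , k) = j < k × Adj G j k × Adj G i j × Adj G i k

  ∈-oppositeEdges⁺ : ∀ {i e} → Opposite i e → e ∈ oppositeEdges i
  ∈-oppositeEdges⁺ {i} (j<k , jk , ij , ik) =
    ∈-filter⁺ (λ (j , k) → adj? G i j ×-dec adj? G i k)
      (∈-filter⁺ (λ (j , k) → (j <? k) ×-dec adj? G j k)
        (∈-cartesianProduct⁺ (∈-allFin _) (∈-allFin _)) (j<k , jk))
      (ij , ik)

  ∈-oppositeEdges⁻ : ∀ {i e} → e ∈ oppositeEdges i → Opposite i e
  ∈-oppositeEdges⁻ {i} e∈
    with e∈E , ij , ik ← ∈-filter⁻ (λ (j , k) → adj? G i j ×-dec adj? G i k) {xs = edges G} e∈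
    with j<k , jk ← ∈-edges⁻ e∈E = j<k , jk , ij , ik

  oppositeEdges-! : ∀ i → Unique (oppositeEdges i)
  oppositeEdges-! i = Unique.filter⁺ (λ (j , k) → adj? G i j ×-dec adj? G i k)
    (Unique.filter⁺ (λ (j , k) → (j <? k) ×-dec adj? G j k)
      (Unique.cartesianProduct⁺ (Unique.allFin⁺ n) (Unique.allFin⁺ n)))

  Balanced : Set
  Balanced = ∀ i → degree G i ≡ suc (edgesAmongNeighbours G i)

-- Effect of attaching a vertex to an edge

module _ (G : Graph n) {u w : Fin n} (u<w : u < w) (uw : Adj G u w) where

  private
    G⁺ : Graph (suc n)
    G⁺ = attach G u w

    lift : Fin n × Fin n → Fin (suc n) × Fin (suc n)
    lift (j , k) = suc j , suc k

    lift-injective : ∀ {e f} → lift e ≡ lift f → e ≡ f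
    lift-injective refl = refl

    lifted-neighbours : ∀ i → map suc (neighbours G i) ⊆ neighbours G⁺ (suc i)
    lifted-neighbours i x∈ with j , j∈ , refl ← ∈-map⁻ suc x∈ =
      ∈-neighbours⁺ G⁺ {suc i} {suc j} (∈-neighbours⁻ G j∈)

    lifted-opposite : ∀ i → map lift (oppositeEdges G i) ⊆ oppositeEdges G⁺ (suc i)
    lifted-opposite i e∈
      with (j , k) , f∈ , refl ← ∈-map⁻ lift e∈
      with j<k , rest ← ∈-oppositeEdges⁻ G f∈ =
      -- Adjacency of old vertices in `G⁺` unfolds to adjacency in `G`, so `rest` carries over
      -- unchanged.
      ∈-oppositeEdges⁺ G⁺ {suc i} {suc j , suc k} (s<s j<k , rest)

    -- Used to see that the new vertex is a genuinely new neighbour, so that prepending it creates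
    -- no repetition.
    zero∉lifted : ∀ {js : List (Fin n)} → ¬ (Fin.zero ∈ map Fin.suc js)
    zero∉lifted 0∈ with _ , _ , () ← ∈-map⁻ Fin.suc 0∈

    zero∉lifted-edge : ∀ {k es} → ¬ ((zero , k) ∈ map lift es)
    zero∉lifted-edge e∈ with _ , _ , () ← ∈-map⁻ lift e∈

  degree-new : degree G⁺ zero ≡ 2
  degree-new = unique-length (neighbours-! G⁺ zero)
    -- The order `u<w` makes the two endpoints distinct, so the degree is 2 and not 1.
    (unique-∷ (λ { (here refl) → <-irrefl refl u<w }) (unique-∷ (λ ()) [])) to from
    where
    to : neighbours G⁺ zero ⊆ suc u ∷ suc w ∷ []
    to {x} x∈ with x | ∈-neighbours⁻ G⁺ {zero} x∈
    ... | suc _ | inj₁ refl = here refl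
    ... | suc _ | inj₂ refl = there (here refl)

    from : suc u ∷ suc w ∷ [] ⊆ neighbours G⁺ zero
    from (here refl)         = ∈-neighbours⁺ G⁺ {zero} {suc u} (inj₁ refl)
    from (there (here refl)) = ∈-neighbours⁺ G⁺ {zero} {suc w} (inj₂ refl)

  opposite-new : edgesAmongNeighbours G⁺ zero ≡ 1
  opposite-new = unique-length (oppositeEdges-! G⁺ zero) (unique-∷ (λ ()) []) to from
    where
    to : oppositeEdges G⁺ zero ⊆ (suc u , suc w) ∷ []
    to {e} e∈ with e | ∈-oppositeEdges⁻ G⁺ {zero} e∈
    -- Of the four ways to choose both ends of the edge from `u` and `w`, the convention that the
    -- smaller end comes first leaves only the pair `u`, `w`.
    ... | suc _ , suc _ | _       , _ , inj₁ refl , inj₂ refl = here refl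
    ... | suc _ , suc _ | s≤s u<u , _ , inj₁ refl , inj₁ refl = contradiction u<u (<-irrefl refl)
    ... | suc _ , suc _ | s≤s w<w , _ , inj₂ refl , inj₂ refl = contradiction w<w (<-irrefl refl)
    ... | suc _ , suc _ | s≤s w<u , _ , inj₂ refl , inj₁ refl = contradiction w<u (<-asym u<w)

    from : (suc u , suc w) ∷ [] ⊆ oppositeEdges G⁺ zero
    from (here refl) = ∈-oppositeEdges⁺ G⁺ {zero} {suc u , suc w} (s<s u<w , uw , inj₁ refl , inj₂ refl)

  degree-endpoint : ∀ {i} → i ≡ u ⊎ i ≡ w → degree G⁺ (suc i) ≡ suc (degree G i)
  degree-endpoint {i} i∈uw = trans
    (unique-length (neighbours-! G⁺ (suc i))
      (unique-∷ zero∉lifted (Unique.map⁺ suc-injective (neighbours-! G i))) to from)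
    (cong suc (length-map suc (neighbours G i)))
    where
    to : neighbours G⁺ (suc i) ⊆ zero ∷ map suc (neighbours G i)
    to {zero}  _  = here refl
    to {suc j} x∈ = there (∈-map⁺ suc (∈-neighbours⁺ G (∈-neighbours⁻ G⁺ {suc i} x∈)))

    from : zero ∷ map suc (neighbours G i) ⊆ neighbours G⁺ (suc i)
    from (here refl) = ∈-neighbours⁺ G⁺ {suc i} {zero} i∈uw
    from (there x∈)  = lifted-neighbours i x∈

  -- Handles both endpoints at once: `i` is one of them and `o` the other. An additional opposite
  -- edge must join the new vertex to a common neighbour of it and `i`, and the last hypothesis
  -- forces that neighbour to be `o`.
  opposite-endpoint : ∀ {i o} → i ≡ u ⊎ i ≡ w → o ≡ u ⊎ o ≡ w → Adj G i o →
    (∀ {j} → j ≡ u ⊎ j ≡ w → Adj G i j → j ≡ o) →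
    edgesAmongNeighbours G⁺ (suc i) ≡ suc (edgesAmongNeighbours G i)
  opposite-endpoint {i} {o} i∈uw o∈uw io only-o = trans
    (unique-length (oppositeEdges-! G⁺ (suc i))
      (unique-∷ zero∉lifted-edge (Unique.map⁺ lift-injective (oppositeEdges-! G i))) to from)
    (cong suc (length-map lift (oppositeEdges G i)))
    where
    to : oppositeEdges G⁺ (suc i) ⊆ (zero , suc o) ∷ map lift (oppositeEdges G i)
    to {e} e∈ with e | ∈-oppositeEdges⁻ G⁺ {suc i} e∈
    -- The new vertex is the least one, so it can only be the first component of a listed edge.
    ... | zero  , suc _ | _ , k∈uw , _ , ik = here (cong (λ k → zero , suc k) (only-o k∈uw ik))
    ... | suc j , suc k | s≤s j<k , rest = there (∈-map⁺ lift (∈-oppositeEdges⁺ G (j<k , rest)))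

    from : (zero , suc o) ∷ map lift (oppositeEdges G i) ⊆ oppositeEdges G⁺ (suc i)
    from (here refl) = ∈-oppositeEdges⁺ G⁺ {suc i} {zero , suc o} (s≤s z≤n , o∈uw , i∈uw , io)
    from (there e∈)  = lifted-opposite i e∈

  degree-other : ∀ {i} → ¬ (i ≡ u ⊎ i ≡ w) → degree G⁺ (suc i) ≡ degree G i
  degree-other {i} i∉uw = trans
    (unique-length (neighbours-! G⁺ (suc i))
      (Unique.map⁺ suc-injective (neighbours-! G i)) to (lifted-neighbours i))
    (length-map suc (neighbours G i))
    where
    to : neighbours G⁺ (suc i) ⊆ map suc (neighbours G i)
    to {zero}  x∈ = contradiction (∈-neighbours⁻ G⁺ {suc i} x∈) i∉uw
    to {suc j} x∈ = ∈-map⁺ suc (∈-neighbours⁺ G (∈-neighbours⁻ G⁺ {suc i} x∈))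

  opposite-other : ∀ {i} → ¬ (i ≡ u ⊎ i ≡ w) →
    edgesAmongNeighbours G⁺ (suc i) ≡ edgesAmongNeighbours G i
  opposite-other {i} i∉uw = trans
    (unique-length (oppositeEdges-! G⁺ (suc i))
      (Unique.map⁺ lift-injective (oppositeEdges-! G i)) to (lifted-opposite i))
    (length-map lift (oppositeEdges G i))
    where
    to : oppositeEdges G⁺ (suc i) ⊆ map lift (oppositeEdges G i)
    to {e} e∈ with e | ∈-oppositeEdges⁻ G⁺ {suc i} e∈
    -- An edge at the new vertex is opposite to `suc i` only if the new vertex is adjacent to
    -- `suc i`, which makes `i` an endpoint.
    ... | zero  , suc _ | _ , _ , i∈uw , _ = contradiction i∈uw i∉uw
    ... | suc j , suc k | s≤s j<k , rest = ∈-map⁺ lift (∈-oppositeEdges⁺ G (j<k , rest))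

  attach-balanced : Balanced G → Balanced G⁺
  attach-balanced bal zero = trans degree-new (cong suc (sym opposite-new))
  attach-balanced bal (suc i) with (i ≟ u) ⊎-dec (i ≟ w)
  ... | no i∉uw = trans (degree-other i∉uw) (trans (bal i) (cong suc (sym (opposite-other i∉uw))))
  ... | yes i∈uw = trans (degree-endpoint i∈uw) (cong suc (trans (bal i) (sym (opposite i∈uw))))
    where
    opposite : ∀ {i} → i ≡ u ⊎ i ≡ w →
      edgesAmongNeighbours G⁺ (suc i) ≡ suc (edgesAmongNeighbours G i)
    -- Irreflexivity excludes the endpoint itself as its own neighbour, leaving the other one.
    opposite (inj₁ refl) = opposite-endpoint (inj₁ refl) (inj₂ refl) uw λ where
      (inj₁ refl) uu → contradiction uu (irrefl G u)
      (inj₂ j≡w)  _  → j≡w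
    opposite (inj₂ refl) = opposite-endpoint (inj₂ refl) (inj₁ refl) (Adj-sym G uw) λ where
      (inj₁ j≡u)  _  → j≡u
      (inj₂ refl) ww → contradiction ww (irrefl G w)

-- Invariance along the random process

K₂-balanced : Balanced K₂
K₂-balanced zero       = refl
K₂-balanced (suc zero) = refl

-- Runs the process backwards: an outcome is traced to an intermediate outcome that can produce it.
-- Only the outcomes matter here, so the product weights are discarded.
∈-support-bind⁻ : (μ : Dist A) (f : A → Dist B) {y : B} → y ∈ support (bind μ f) →
  ∃[ x ] x ∈ support μ × y ∈ support (f x)
∈-support-bind⁻ μ f y∈
  with _ , qy∈ , refl ← ∈-map⁻ proj₂ y∈
  with (p , x) , px∈ , qy∈f ← find (∈-concatMap⁻ (λ (p , x) → map _ (f x)) {xs = μ} qy∈)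
  with _ , ry∈ , refl ← ∈-map⁻ _ qy∈f =
  x , ∈-map⁺ proj₂ px∈ , ∈-map⁺ proj₂ ry∈

-- The support forgets weights, so any common weight `p` will do; `uniform` is the case of one over
-- the length.
∈-map-weighted⁻ : (p : A) (xs : List B) {x : B} → x ∈ map proj₂ (map (p ,_) xs) → x ∈ xs
∈-map-weighted⁻ p xs x∈
  with _ , px∈ , refl ← ∈-map⁻ proj₂ x∈
  with _ , x∈xs , refl ← ∈-map⁻ (p ,_) px∈ = x∈xs

∈-support-uniform⁻ : (xs : List A) .{{_ : NonZero (length xs)}} {x : A} →
  x ∈ support (uniform xs) → x ∈ xs
∈-support-uniform⁻ xs = ∈-map-weighted⁻ (+ 1 / length xs) xs

∈-support-return⁻ : {x y : A} → y ∈ support (return x) → y ≡ x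
∈-support-return⁻ (here y≡x) = y≡x

∈-support-step⁻ : (G : Graph n) (ne : HasEdge G) {s : State (suc n)} → s ∈ support (step (G , ne)) →
  ∃[ e ] e ∈ edges G × s ≡ grow G e
∈-support-step⁻ G ne s∈ =
  let e , e∈ , s∈e = ∈-support-bind⁻ (uniform (edges G) {{ne}}) (λ e → return (grow G e)) s∈
  in e , ∈-support-uniform⁻ (edges G) {{ne}} e∈ , ∈-support-return⁻ s∈e

process-balanced : ∀ t {s} → s ∈ support (process t) → Balanced (proj₁ s)
process-balanced zero    s∈ = subst (λ s → Balanced (proj₁ s)) (sym (∈-support-return⁻ s∈)) K₂-balanced
process-balanced (suc t) s∈ =
  let (G , ne) , G∈ , s∈step = ∈-support-bind⁻ (process t) step s∈
      _ , e∈ , s≡            = ∈-support-step⁻ G ne s∈step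
      -- Being a listed edge supplies both hypotheses of `attach-balanced`, the order and the
      -- adjacency.
      u<w , uw               = ∈-edges⁻ G e∈
  in subst (λ s → Balanced (proj₁ s)) (sym s≡) (attach-balanced G u<w uw (process-balanced t G∈))

-- Arithmetic of the coefficient

/-cross : ∀ p q m n .{{_ : NonZero m}} .{{_ : NonZero n}} → p ℤ.* + n ≡ q ℤ.* + m → p / m ≡ q / n
-- `mkℚᵘ p m` denotes the fraction with denominator `suc m`. Equality of unnormalised fractions is
-- cross-multiplication, and normalising respects it.
/-cross p q (suc m) (suc n) eq = fromℚᵘ-cong {mkℚᵘ p m} {mkℚᵘ q n} (*≡* eq)

2[d-1]/d[d-1]≡2/d : ∀ d e .{{_ : NonTrivial d}} → d ≡ suc e →
  (+ (2 * e) / (d * (d ∸ 1))) {{d[d-1]≢0 d}} ≡ (+ 2 / d) {{nonTrivial⇒nonZero d}}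
2[d-1]/d[d-1]≡2/d d e d≡1+e =
  /-cross (+ (2 * e)) (+ 2) (d * (d ∸ 1)) d {{d[d-1]≢0 d}} {{nonTrivial⇒nonZero d}} (cross d≡1+e)
  where
  cross : ∀ {d e} → d ≡ suc e → + (2 * e) ℤ.* + d ≡ + 2 ℤ.* + (d * (d ∸ 1))
  -- With `d` replaced by `suc e`, the term `d ∸ 1` reduces to `e`. Both sides are then twice the
  -- product of `e` and `suc e`, compared in the naturals through `pos-*`.
  cross {e = e} refl = trans (sym (pos-* (2 * e) (suc e))) (trans
    (cong +_ (trans (*-assoc 2 e (suc e)) (cong (2 *_) (*-comm e (suc e)))))
    (pos-* 2 (suc e * e)))

theorem7 : ∀ (t : ℕ) (G : Graph (2 +ℕ t)) (ne : HasEdge G) → (G , ne) ∈ support (process t) → ∀ (i : Fin (2 +ℕ t)) .{{nt : NonTrivial (degree G i)}} → localClustering G i ≡ (+ 2 / degree G i) {{nonTrivial⇒nonZero (degree G i)}}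
theorem7 t G ne G∈ i = 2[d-1]/d[d-1]≡2/d (degree G i) (edgesAmongNeighbours G i) (process-balanced t G∈ i)
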